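{- Let $d,k\in\mathbb{N}$. (i) If $k\ge 8$, then every $5$-dimensional grid is equitably $k$-list arborable. (ii) If $6\le d\le 16$ and $k\ge 2d-2+\frac{2d-4}{7}$, then every $d$-dimensional grid is equitably $k$-list arborable. (iii) If $d\ge 17$ and $k\ge 2d-3+\frac{2d-3}{6}$, then every $d$-dimensional grid is equitably $k$-list arborable.
   Context: $P_n$ denotes the path on $n$ vertices and $\square$ the Cartesian product of graphs. A $d$-dimensional grid is a graph $P_{n_1}\square\cdots\square P_{n_d}$ with every $n_i\ge 2$. A $k$-uniform list assignment $L$ for a graph $G$ assigns to each vertex $v$ a set $L(v)$ of exactly $k$ colours; an $L$-colouring is a map $c$ with $c(v)\in L(v)$ for all $v$; it is equitable if every colour class has at most $\lceil |V(G)|/k\rceil$ vertices. $G$ is equitably $k$-list arborable if for every $k$-uniform list assignment $L$ there is an equitable $L$-colouring of $G$ in which every colour class induces an acyclic subgraph. -}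

module Defs where

open import Data.Nat using (ℕ; zero; suc; _+_; _*_; _≤_; _<_)
open import Data.Nat.DivMod using (_/_)
open import Data.Fin using (Fin)
open import Data.Vec using (Vec; lookup; foldr)
open import Data.List using (List; []; _∷_; length; last)
open import Data.List.Relation.Unary.All using (All)
open import Data.List.Relation.Unary.Unique.Propositional using (Unique)
open import Data.List.Relation.Unary.Linked using (Linked)
open import Data.List.Membership.Propositional using (_∈_)
open import Data.Maybe using (just)
open import Data.Product using (Σ; ∃; _×_)
open import Data.Sum using (_⊎_)
open import Relation.Binary.PropositionalEquality using (_≡_; _≢_)
open import Relation.Nullary using (¬_)
open import Data.Empty using (⊥)

-- A d-dimensional grid P_{n_1} □ ... □ P_{n_d} is given by the side lengths
-- n : Vec ℕ d.  Its vertices are the vectors x : Vec ℕ d with x_i < n_i.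
InGrid : ∀ {d} → Vec ℕ d → Vec ℕ d → Set
InGrid {d} n x = (i : Fin d) → lookup x i < lookup n i

Adj : ∀ {d} → Vec ℕ d → Vec ℕ d → Set
Adj {d} x y = Σ (Fin d) λ i →
  ((lookup x i ≡ suc (lookup y i)) ⊎ (lookup y i ≡ suc (lookup x i)))
  × ((j : Fin d) → j ≢ i → lookup x j ≡ lookup y j)

numVertices : ∀ {d} → Vec ℕ d → ℕ
numVertices = foldr _ _*_ 1

-- ceiling division ⌈ N / k ⌉  (only used with k ≥ 1; value 0 for k = 0)
ceilDiv : ℕ → ℕ → ℕ
ceilDiv N zero = 0
ceilDiv N (suc k) = (N + k) / suc k

UniformListAssignment : ∀ {d} → Vec ℕ d → ℕ → (Vec ℕ d → List ℕ) → Set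
UniformListAssignment n k L =
  ∀ x → InGrid n x → Unique (L x) × length (L x) ≡ k

IsLColouring : ∀ {d} → Vec ℕ d → (Vec ℕ d → List ℕ) → (Vec ℕ d → ℕ) → Set
IsLColouring n L c = ∀ x → InGrid n x → c x ∈ L x

ClassSizeAtMost : ∀ {d} → Vec ℕ d → (Vec ℕ d → ℕ) → ℕ → ℕ → Set
ClassSizeAtMost {d} n c a m =
  (vs : List (Vec ℕ d)) → Unique vs → All (λ v → InGrid n v × c v ≡ a) vs →
  length vs ≤ m

IsEquitable : ∀ {d} → Vec ℕ d → ℕ → (Vec ℕ d → ℕ) → Set
IsEquitable n k c = ∀ a → ClassSizeAtMost n c a (ceilDiv (numVertices n) k)

CycleInClass : ∀ {d} → Vec ℕ d → (Vec ℕ d → ℕ) → ℕ → List (Vec ℕ d) → Set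
CycleInClass n c a [] = ⊥
CycleInClass n c a (v ∷ vs) =
  (3 ≤ length (v ∷ vs)) × Unique (v ∷ vs)
  × All (λ w → InGrid n w × c w ≡ a) (v ∷ vs)
  × Linked Adj (v ∷ vs)
  × (∃ λ w → last (v ∷ vs) ≡ just w × Adj w v)

ClassesAcyclic : ∀ {d} → Vec ℕ d → (Vec ℕ d → ℕ) → Set
ClassesAcyclic {d} n c = ∀ a (vs : List (Vec ℕ d)) → ¬ CycleInClass n c a vs

EquitablyListArborable : ∀ {d} → Vec ℕ d → ℕ → Set
EquitablyListArborable {d} n k =
  (L : Vec ℕ d → List ℕ) → UniformListAssignment n k L →
  Σ (Vec ℕ d → ℕ) λ c → IsLColouring n L c × IsEquitable n k c × ClassesAcyclic n c

IsGrid : ∀ {d} → Vec ℕ d → Set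
IsGrid {d} n = (i : Fin d) → 2 ≤ lookup n i

{-# OPTIONS --safe #-}
module Submission where

open import Defs
open import Data.Nat using (ℕ; zero; suc; _+_; _*_; _∸_; _≤_; _<_; _≟_; _≤?_; _<?_; z≤n; s≤s; pred)
open import Data.Nat.Properties using
  ( ≤-refl; ≤-trans; ≤-reflexive; ≤-pred; <-irrefl; <⇒≤; ≤⇒≯; ≮⇒≥; ≰⇒>; n≢0⇒n>0; 1+n≢n
  ; n≤1+n; m≤m+n; m≤n+m; m<n+m; m≤n+m∸n; m≤n+o⇒m∸n≤o; m<n⇒0<n∸m; m+[n∸m]≡n
  ; +-comm; +-suc; +-mono-≤; +-mono-<-≤; +-mono-≤-<; +-monoʳ-≤; +-monoˡ-≤; +-cancelˡ-≤; +-cancelʳ-≤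
  ; *-comm; *-distribˡ-+; *-distribʳ-+; *-zeroʳ; *-identityʳ; *-monoʳ-≤; *-monoˡ-≤
  ; *-cancelˡ-≤; *-cancelʳ-≤; module ≤-Reasoning )
open import Data.Nat.DivMod using (_/_; _%_; m≡m%n+[m/n]*n; m%n<n)
open import Data.Nat.ListAction using (sum)
open import Data.Nat.Tactic.RingSolver using (solve-∀)
open import Data.Fin using (zero; suc)
open import Data.Fin.Properties using (any?; all?) renaming (_≟_ to _≟ᶠ_)
open import Data.Vec using (Vec; []; _∷_; lookup)
open import Data.Vec.Properties using (≡-dec; tabulate∘lookup; tabulate-cong; ∷-injective)
open import Data.List using (List; []; _∷_; length; map; filter; downFrom; cartesianProductWith; deduplicate; last)
open import Data.List.Properties using (filter-notAll; length-map; length-++; length-downFrom)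
open import Data.List.Membership.Propositional using (_∈_; _∉_; find; lose)
open import Data.List.Membership.Propositional.Properties using
  ( ∈-filter⁺; ∈-filter⁻; ∈-map⁺; ∈-map⁻; ∈-cartesianProductWith⁺; ∈-cartesianProductWith⁻
  ; ∈-downFrom⁺; ∈-downFrom⁻; ∈-deduplicate⁺ )
open import Data.List.Membership.DecPropositional _≟_ using (_∈?_; _∉?_)
open import Data.List.Relation.Unary.All as All using (All; []; _∷_)
import Data.List.Relation.Unary.All.Properties as All
open import Data.List.Relation.Unary.Any using (Any; here; there) renaming (any? to anyᴸ?)
open import Data.List.Relation.Unary.AllPairs as AllPairs using (AllPairs; []; _∷_)
import Data.List.Relation.Unary.AllPairs.Properties as AllPairs
open import Data.List.Relation.Unary.Linked using (Linked; _∷_)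
open import Data.List.Relation.Unary.Unique.Propositional using (Unique)
open import Data.List.Relation.Unary.Unique.Propositional.Properties using (filter⁺; downFrom⁺; cartesianProductWith⁺)
open import Data.List.Relation.Unary.Unique.DecPropositional.Properties _≟_ using (deduplicate-!)
open import Data.Maybe using (just)
open import Data.Product using (∃; ∃₂; _×_; _,_; proj₁; proj₂)
open import Data.Sum using (_⊎_; inj₁; inj₂)
open import Data.Empty using (⊥; ⊥-elim)
open import Function using (_∘_; id; case_of_)
open import Relation.Binary.Definitions using (DecidableEquality)
open import Relation.Binary.PropositionalEquality using (_≡_; _≢_; refl; sym; trans; cong; cong₂; subst)
open import Relation.Nullary using (¬_; Dec; yes; no; ¬?; contradiction)
open import Relation.Nullary.Decidable using (_×-dec_; _⊎-dec_; _→-dec_)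
open import Relation.Unary using (Decidable)

-- All three ranges satisfy 3d ≤ 2k, and this suffices.  Let m = ⌈N/k⌉, and colour the vertices in
-- lexicographic order, so that each new vertex v has at most d coloured neighbours.  Moving a
-- vertex to a colour of its list that at most one of its neighbours has keeps the classes
-- acyclic.  Let B be the set of colours from which no chain of such moves leads to a colour
-- with fewer than m vertices.  If v may receive a colour outside B, a chain of moves makes room
-- for it.  Otherwise v, and by the choice of B also every vertex coloured from B, has two
-- neighbours in each of the at least a = k − |B| colours of its list outside B.  For v this gives
-- 2a ≤ d, hence |B| ≥ d.  The classes of B are full, so v and the vertices coloured from B form a
-- set W of at least |B|m + 1 elements, and fewer than am vertices have a colour outside B;
-- in particular a > 0.  Counting the edges between W and the latter vertices, whose degrees
-- are at most 2d, gives 2a(|B|m + 1) < 2dam ≤ 2a|B|m, a contradiction.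

-- Indicators and finite sums.

⟦_⟧ : ∀ {P : Set} → Dec P → ℕ
⟦ yes _ ⟧ = 1
⟦ no  _ ⟧ = 0

⟦⟧-yes : ∀ {P : Set} (p? : Dec P) → P → ⟦ p? ⟧ ≡ 1
⟦⟧-yes (yes _) _ = refl
⟦⟧-yes (no ¬p) p = contradiction p ¬p

⟦⟧-no : ∀ {P : Set} (p? : Dec P) → ¬ P → ⟦ p? ⟧ ≡ 0
⟦⟧-no (yes p) ¬p = contradiction p ¬p
⟦⟧-no (no _)  _  = refl

⟦⟧-mono : ∀ {P Q : Set} (p? : Dec P) (q? : Dec Q) → (P → Q) → ⟦ p? ⟧ ≤ ⟦ q? ⟧
⟦⟧-mono (no _)  _  _ = z≤n
⟦⟧-mono (yes p) q? f = ≤-reflexive (sym (⟦⟧-yes q? (f p)))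

⟦⟧≤1 : ∀ {P : Set} (p? : Dec P) → ⟦ p? ⟧ ≤ 1
⟦⟧≤1 (yes _) = ≤-refl
⟦⟧≤1 (no _)  = z≤n

private variable
  A B : Set
  x : A
  xs ys : List A

∑ : List A → (A → ℕ) → ℕ
∑ xs f = sum (map f xs)

syntax ∑ xs (λ x → e) = ∑[ x ∈ xs ] e

∑-mono : ∀ (xs : List A) {f g} → (∀ {x} → x ∈ xs → f x ≤ g x) → ∑ xs f ≤ ∑ xs g
∑-mono []       f≤g = z≤n
∑-mono (x ∷ xs) f≤g = +-mono-≤ (f≤g (here refl)) (∑-mono xs (f≤g ∘ there))

∑-mono-< : ∀ {f g} → (∀ {y} → y ∈ xs → f y ≤ g y) → x ∈ xs → f x < g x → ∑ xs f < ∑ xs g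
∑-mono-< f≤g (here refl) fx<gx = +-mono-<-≤ fx<gx (∑-mono _ (f≤g ∘ there))
∑-mono-< f≤g (there x∈)  fx<gx = +-mono-≤-< (f≤g (here refl)) (∑-mono-< (f≤g ∘ there) x∈ fx<gx)

∑-const : ∀ (xs : List A) n → ∑ xs (λ _ → n) ≡ length xs * n
∑-const []       n = refl
∑-const (x ∷ xs) n = cong (n +_) (∑-const xs n)

∑-+ : ∀ (xs : List A) f g → ∑[ x ∈ xs ] (f x + g x) ≡ ∑ xs f + ∑ xs g
∑-+ []       f g = refl
∑-+ (x ∷ xs) f g rewrite ∑-+ xs f g = interchange (f x) (g x) (∑ xs f) (∑ xs g)
  where
  interchange : ∀ a b c d → a + b + (c + d) ≡ a + c + (b + d)
  interchange = solve-∀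

∑-*ˡ : ∀ n (xs : List A) f → n * ∑ xs f ≡ ∑[ x ∈ xs ] (n * f x)
∑-*ˡ n []       f = *-zeroʳ n
∑-*ˡ n (x ∷ xs) f = trans (*-distribˡ-+ n (f x) (∑ xs f)) (cong (n * f x +_) (∑-*ˡ n xs f))

∑-swap : ∀ (xs : List A) (ys : List B) (f : A → B → ℕ) →
  ∑[ x ∈ xs ] ∑[ y ∈ ys ] f x y ≡ ∑[ y ∈ ys ] ∑[ x ∈ xs ] f x y
∑-swap []       ys f = sym (trans (∑-const ys 0) (*-zeroʳ (length ys)))
∑-swap (x ∷ xs) ys f =
  trans (cong (∑ ys (f x) +_) (∑-swap xs ys f)) (sym (∑-+ ys (f x) (λ y → ∑[ x ∈ xs ] f x y)))

∑-filter : ∀ {P : A → Set} (P? : Decidable P) xs f →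
  ∑ (filter P? xs) f ≡ ∑[ x ∈ xs ] (f x * ⟦ P? x ⟧)
∑-filter P? []       f = refl
∑-filter P? (x ∷ xs) f with P? x
... | yes _ = cong₂ _+_ (sym (*-identityʳ (f x))) (∑-filter P? xs f)
... | no  _ rewrite *-zeroʳ (f x) = ∑-filter P? xs f

length-filter≡∑ : ∀ {P : A → Set} (P? : Decidable P) xs → length (filter P? xs) ≡ ∑[ x ∈ xs ] ⟦ P? x ⟧
length-filter≡∑ P? []       = refl
length-filter≡∑ P? (x ∷ xs) with P? x
... | yes _ = cong suc (length-filter≡∑ P? xs)
... | no  _ = length-filter≡∑ P? xs

length-filter-split : ∀ {P : A → Set} (P? : Decidable P) xs →
  length (filter P? xs) + length (filter (¬? ∘ P?) xs) ≡ length xs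
length-filter-split P? []       = refl
length-filter-split P? (x ∷ xs) with P? x
... | yes _ = cong suc (length-filter-split P? xs)
... | no  _ = trans (+-suc _ _) (cong suc (length-filter-split P? xs))

≤-length*∑ : ∀ (xs : List A) f n → (∀ {x} → x ∈ xs → n ≤ f x) → length xs * n ≤ ∑ xs f
≤-length*∑ xs f n n≤f = ≤-trans (≤-reflexive (sym (∑-const xs n))) (∑-mono xs n≤f)

∑≤length* : ∀ (xs : List A) f n → (∀ {x} → x ∈ xs → f x ≤ n) → ∑ xs f ≤ length xs * n
∑≤length* xs f n f≤n = ≤-trans (∑-mono xs f≤n) (≤-reflexive (∑-const xs n))

-- Counting in lists without repetitions.

module _ {A : Set} (_≟′_ : DecidableEquality A) where

  ∑-≡-0 : ∀ {xs} y → All (y ≢_) xs → ∑[ x ∈ xs ] ⟦ y ≟′ x ⟧ ≡ 0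
  ∑-≡-0 y []         = refl
  ∑-≡-0 y (y≢x ∷ ps) = cong₂ _+_ (⟦⟧-no (y ≟′ _) y≢x) (∑-≡-0 y ps)

  ∑-≡-≤1 : ∀ {xs} y → Unique xs → ∑[ x ∈ xs ] ⟦ y ≟′ x ⟧ ≤ 1
  ∑-≡-≤1 y []                        = z≤n
  ∑-≡-≤1 y (_∷_ {x} x∉ xs!) with y ≟′ x
  ... | yes refl = ≤-reflexive (cong suc (∑-≡-0 y x∉))
  ... | no  _    = ∑-≡-≤1 y xs!

  1≤∑-≡ : ∀ {xs y} → y ∈ xs → 1 ≤ ∑[ x ∈ xs ] ⟦ y ≟′ x ⟧
  1≤∑-≡ {y = y} (here {x} y≡x) = ≤-trans (≤-reflexive (sym (⟦⟧-yes (y ≟′ x) y≡x))) (m≤m+n _ _)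
  1≤∑-≡ (there y∈)   = ≤-trans (1≤∑-≡ y∈) (m≤n+m _ _)

  -- Double counting of the pairs of equal entries: each entry of `xs` meets at least one of `ys`,
  -- each entry of `ys` at most one of `xs`.
  Unique-⊆⇒length≤ : ∀ {xs ys} → Unique xs → (∀ {x} → x ∈ xs → x ∈ ys) → length xs ≤ length ys
  Unique-⊆⇒length≤ {xs = xs} {ys = ys} xs! xs⊆ys = begin
    length xs                                ≡⟨ *-identityʳ _ ⟨
    length xs * 1                            ≤⟨ ≤-length*∑ xs _ 1 (1≤∑-≡ ∘ xs⊆ys) ⟩
    ∑[ x ∈ xs ] ∑[ y ∈ ys ] ⟦ x ≟′ y ⟧       ≡⟨ ∑-swap xs ys (λ x y → ⟦ x ≟′ y ⟧) ⟩
    ∑[ y ∈ ys ] ∑[ x ∈ xs ] ⟦ x ≟′ y ⟧       ≤⟨ ∑≤length* ys _ 1 (λ {y} _ →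
      ≤-trans (∑-mono xs (λ {x} _ → ⟦⟧-mono (x ≟′ y) (y ≟′ x) sym)) (∑-≡-≤1 y xs!)) ⟩
    length ys * 1                            ≡⟨ *-identityʳ _ ⟩
    length ys                                ∎
    where open ≤-Reasoning

  -- Applied with `y` the colour of a vertex: a sum over distinct colours counts that vertex at most
  -- once.
  ∑-≡-≤⟦⟧ : ∀ {P : A → Set} (P? : Decidable P) {xs} → Unique xs → (∀ {x} → x ∈ xs → P x) →
    ∀ y → ∑[ x ∈ xs ] ⟦ y ≟′ x ⟧ ≤ ⟦ P? y ⟧
  ∑-≡-≤⟦⟧ P? xs! xs⊆P y with P? y
  ... | yes _  = ∑-≡-≤1 y xs!
  ... | no ¬Py = ≤-reflexive (∑-≡-0 y (All.tabulate λ { x∈ refl → ¬Py (xs⊆P x∈) }))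

∈⇒≤∑ : ∀ (f : A → ℕ) → x ∈ xs → f x ≤ ∑ xs f
∈⇒≤∑ f (here refl) = m≤m+n _ _
∈⇒≤∑ f (there x∈)  = ≤-trans (∈⇒≤∑ f x∈) (m≤n+m _ _)

2≤∑ : ∀ {y : A} (f : A → ℕ) → x ∈ xs → y ∈ xs → x ≢ y → 1 ≤ f x → 1 ≤ f y → 2 ≤ ∑ xs f
2≤∑ f (here refl) (here refl) x≢y 1≤fx 1≤fy = contradiction refl x≢y
2≤∑ f (here refl) (there y∈)  x≢y 1≤fx 1≤fy = +-mono-≤ 1≤fx (≤-trans 1≤fy (∈⇒≤∑ f y∈))
2≤∑ f (there x∈)  (here refl) x≢y 1≤fx 1≤fy =
  +-mono-≤ 1≤fy (≤-trans 1≤fx (∈⇒≤∑ f x∈))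
2≤∑ f (there x∈)  (there y∈)  x≢y 1≤fx 1≤fy = ≤-trans (2≤∑ f x∈ y∈ x≢y 1≤fx 1≤fy) (m≤n+m _ _)

-- Valid partial colourings of a graph, and the recolouring of one vertex.

module Recolouring {V : Set} (_≟ᵛ_ : DecidableEquality V)
  {_~_ : V → V → Set} (_~?_ : ∀ (x y : V) → Dec (x ~ y))
  (~-sym : ∀ {x y : V} → x ~ y → y ~ x) (~-irrefl : ∀ {x : V} → ¬ x ~ x)
  (L : V → List ℕ) (m : ℕ) where

  Colouring : Set
  Colouring = V → ℕ

  -- An order-free substitute for cycles: every cycle is a core, and adding a vertex with at
  -- most one neighbour creates no core.
  Core : List V → Set
  Core T = (∃ λ x → x ∈ T)
    × (∀ {x} → x ∈ T → ∃₂ λ y z → y ∈ T × z ∈ T × y ≢ z × x ~ y × x ~ z)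

  Coreless : List V → Colouring → Set
  Coreless xs c = ∀ a {T} → Core T → ¬ All (λ x → x ∈ xs × c x ≡ a) T

  size : List V → Colouring → ℕ → ℕ
  size xs c a = ∑[ x ∈ xs ] ⟦ c x ≟ a ⟧

  nbrs : List V → Colouring → V → ℕ → ℕ
  nbrs xs c v a = ∑[ y ∈ xs ] (⟦ v ~? y ⟧ * ⟦ c y ≟ a ⟧)

  record Valid (xs : List V) (c : Colouring) : Set where
    field
      fromList : ∀ {x} → x ∈ xs → c x ∈ L x
      bounded  : ∀ a → size xs c a ≤ m
      coreless : Coreless xs c

  open Valid

  _[_≔_] : Colouring → V → ℕ → Colouring
  (c [ v ≔ b ]) y with y ≟ᵛ v
  ... | yes _ = b
  ... | no  _ = c y

  ≔-≡ : ∀ c v b → (c [ v ≔ b ]) v ≡ b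
  ≔-≡ c v b with v ≟ᵛ v
  ... | yes _  = refl
  ... | no v≢v = contradiction refl v≢v

  ≔-≢ : ∀ c {v b y} → y ≢ v → (c [ v ≔ b ]) y ≡ c y
  ≔-≢ c {v} {y = y} y≢v with y ≟ᵛ v
  ... | yes y≡v = contradiction y≡v y≢v
  ... | no _    = refl

  ≔-inv : ∀ c {v b y e} → (c [ v ≔ b ]) y ≡ e → (y ≡ v × b ≡ e) ⊎ (y ≢ v × c y ≡ e)
  ≔-inv c {v} {y = y} eq with y ≟ᵛ v
  ... | yes y≡v = inj₁ (y≡v , eq)
  ... | no  y≢v = inj₂ (y≢v , eq)

  ≔-shrinks : ∀ {c v b y e} → e ≢ b → (c [ v ≔ b ]) y ≡ e → c y ≡ e
  ≔-shrinks {c} e≢b eq with ≔-inv c eq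
  ... | inj₁ (_ , b≡e)  = contradiction (sym b≡e) e≢b
  ... | inj₂ (_ , cy≡e) = cy≡e

  ≔-fromList : ∀ {c v b ys} → (∀ {y} → y ∈ ys → y ≢ v → c y ∈ L y) → b ∈ L v →
    ∀ {y} → y ∈ ys → (c [ v ≔ b ]) y ∈ L y
  ≔-fromList {v = v} c∈L b∈L {y} y∈ with y ≟ᵛ v
  ... | yes refl = b∈L
  ... | no  y≢v  = c∈L y∈ y≢v

  -- A core avoiding `v` was monochromatic before. A core containing `v` has colour `b` and would
  -- give `v` two distinct neighbours of that colour. With `ys` equal to `xs` this serves a move,
  -- with `v ∷ xs` an insertion.
  ≔-coreless : ∀ {xs ys c v b} → (∀ {y} → y ∈ ys → y ≢ v → y ∈ xs) → nbrs xs c v b ≤ 1 →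
    Coreless xs c → Coreless ys (c [ v ≔ b ])
  ≔-coreless {xs} {ys} {c} {v} {b} ys⊆xs nbrs≤1 coreless a {T} core@(_ , deg) T⊆ys
    with anyᴸ? (v ≟ᵛ_) T
  ... | no v∉T = coreless a core (All.tabulate old)
    where
    old : ∀ {y} → y ∈ T → y ∈ xs × c y ≡ a
    old y∈T with All.lookup T⊆ys y∈T
    ... | y∈ys , eq = ys⊆xs y∈ys y≢v , trans (sym (≔-≢ c y≢v)) eq
      where y≢v = λ { refl → v∉T y∈T }
  ... | yes v∈T with deg v∈T
  ...   | y , z , y∈T , z∈T , y≢z , v~y , v~z =
    ≤⇒≯ nbrs≤1 (2≤∑ _ (proj₁ (old y∈T v~y)) (proj₁ (old z∈T v~z)) y≢z
                     (proj₂ (old y∈T v~y)) (proj₂ (old z∈T v~z)))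
    where
    b≡a = trans (sym (≔-≡ c v b)) (proj₂ (All.lookup T⊆ys v∈T))
    old : ∀ {y} → y ∈ T → v ~ y → y ∈ xs × 1 ≤ ⟦ v ~? y ⟧ * ⟦ c y ≟ b ⟧
    old {y} y∈T v~y with All.lookup T⊆ys y∈T
    ... | y∈ys , eq = ys⊆xs y∈ys y≢v ,
      ≤-reflexive (sym (cong₂ _*_ (⟦⟧-yes (v ~? y) v~y)
        (⟦⟧-yes (c y ≟ b) (trans (sym (≔-≢ c y≢v)) (trans eq (sym b≡a))))))
      where y≢v = λ { refl → ~-irrefl v~y }

  ≔-size-≢ : ∀ xs {c v a b} → a ≢ b → size xs (c [ v ≔ b ]) a ≤ size xs c a
  ≔-size-≢ xs {c} {v} {a} {b} a≢b = ∑-mono xs λ {y} _ → ⟦⟧-mono _ (c y ≟ a) (≔-shrinks a≢b)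

  ≔-size-< : ∀ {xs c x a b} → x ∈ xs → c x ≡ a → a ≢ b → size xs (c [ x ≔ b ]) a < size xs c a
  ≔-size-< {xs} {c} {x} {a} {b} x∈ cx≡a a≢b =
    ∑-mono-< (λ {y} _ → ⟦⟧-mono _ (c y ≟ a) (≔-shrinks a≢b)) x∈
      (≤-reflexive (trans (cong suc (⟦⟧-no _ λ eq → a≢b (trans (sym eq) (≔-≡ c x b))))
                          (sym (⟦⟧-yes (c x ≟ a) cx≡a))))

  ≔-size-≤ : ∀ {xs c v b} → Unique xs → size xs (c [ v ≔ b ]) b ≤ suc (size xs c b)
  ≔-size-≤ {xs} {c} {v} {b} xs! = begin
    size xs (c [ v ≔ b ]) b                           ≤⟨ ∑-mono xs (λ {y} _ → pointwise y) ⟩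
    ∑[ y ∈ xs ] (⟦ v ≟ᵛ y ⟧ + ⟦ c y ≟ b ⟧)            ≡⟨ ∑-+ xs _ _ ⟩
    ∑[ y ∈ xs ] ⟦ v ≟ᵛ y ⟧ + size xs c b              ≤⟨ +-monoˡ-≤ _ (∑-≡-≤1 _≟ᵛ_ v xs!) ⟩
    suc (size xs c b)                                 ∎
    where
    open ≤-Reasoning
    pointwise : ∀ y → ⟦ (c [ v ≔ b ]) y ≟ b ⟧ ≤ ⟦ v ≟ᵛ y ⟧ + ⟦ c y ≟ b ⟧
    pointwise y with (c [ v ≔ b ]) y ≟ b
    ... | no _ = z≤n
    ... | yes eq with ≔-inv c eq
    ...   | inj₁ (y≡v , _)  = ≤-trans (≤-reflexive (sym (⟦⟧-yes (v ≟ᵛ y) (sym y≡v)))) (m≤m+n _ _)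
    ...   | inj₂ (_ , cy≡b) = ≤-trans (≤-reflexive (sym (⟦⟧-yes (c y ≟ b) cy≡b))) (m≤n+m _ _)

  -- Chains of moves, and the insertion of a new vertex.

  nbrs-mono : ∀ xs {c c′ v a} → (∀ {y} → c′ y ≡ a → c y ≡ a) → nbrs xs c′ v a ≤ nbrs xs c v a
  nbrs-mono xs {c} {c′} {v} {a} c′⊆c =
    ∑-mono xs λ {y} _ → *-monoʳ-≤ ⟦ v ~? y ⟧ (⟦⟧-mono (c′ y ≟ a) (c y ≟ a) c′⊆c)

  -- The chain of recolourings avoids the colours in X; adding a to X along the chain makes it
  -- a simple path, so that its moves can be carried out one after the other from the far end.
  data Free (xs : List V) (c : Colouring) (X : List ℕ) (a : ℕ) : Set where
    room : a ∉ X → size xs c a < m → Free xs c X a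
    step : ∀ {x b} → a ∉ X → x ∈ xs → c x ≡ a → b ∈ L x → nbrs xs c x b ≤ 1 →
           Free xs c (a ∷ X) b → Free xs c X a

  Free⇒∉ : ∀ {xs c X a} → Free xs c X a → a ∉ X
  Free⇒∉ (room a∉X _)         = a∉X
  Free⇒∉ (step a∉X _ _ _ _ _) = a∉X

  Free-anti : ∀ {xs c X Y a} → (∀ {e} → e ∈ Y → e ∈ X) → Free xs c X a → Free xs c Y a
  Free-anti Y⊆X (room a∉X a<m) = room (a∉X ∘ Y⊆X) a<m
  Free-anti Y⊆X (step a∉X x∈ cx≡a b∈L nbrs≤1 free) =
    step (a∉X ∘ Y⊆X) x∈ cx≡a b∈L nbrs≤1
      (Free-anti (λ { (here e≡a) → here e≡a ; (there e∈Y) → there (Y⊆X e∈Y) }) free)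

  -- What the preceding move of a chain needs once the moves beyond it are made. By `shrinks`, the
  -- vertex about to enter class `a` meets no new neighbours there. The colours passed before `a`
  -- lie in `X`, and `keeps` and `reflects` leave their classes unchanged.
  record Shifted (xs : List V) (c : Colouring) (X : List ℕ) (a : ℕ) : Set where
    field
      c′       : Colouring
      valid    : Valid xs c′
      vacant   : size xs c′ a < m
      shrinks  : ∀ {y} → c′ y ≡ a → c y ≡ a
      keeps    : ∀ {y e} → e ∈ X → c y ≡ e → c′ y ≡ e
      reflects : ∀ {y e} → e ∈ X → c′ y ≡ e → c y ≡ e

  -- Induction from the far end of the chain: the recursive call makes room in class `b`, then `x`
  -- moves there and leaves room in class `a`.
  shift : ∀ {xs c X a} → Unique xs → Valid xs c → Free xs c X a → Shifted xs c X a
  shift {c = c} xs! val (room _ a<m) = record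
    { c′ = c ; valid = val ; vacant = a<m ; shrinks = id ; keeps = λ _ → id ; reflects = λ _ → id }
  shift {xs} {c} {X} {a} xs! val (step {x} {b} a∉X x∈ cx≡a b∈L nbrs≤1 free) = record
    { c′ = c₁ [ x ≔ b ]
    ; valid = record
      { fromList = ≔-fromList (λ y∈ _ → fromList S.valid y∈) b∈L
      ; bounded  = bounded′
      ; coreless = ≔-coreless (λ y∈ _ → y∈) (≤-trans (nbrs-mono xs S.shrinks) nbrs≤1)
                     (coreless S.valid)
      }
    -- The rest of the chain leaves class `a` alone, so `x` still has colour `a`; its departure
    -- brings a class of at most `m` vertices below `m`.
    ; vacant   = ≤-trans (≔-size-< x∈ (S.keeps (here refl) cx≡a) a≢b) (bounded S.valid a)
    ; shrinks  = λ eq → S.reflects (here refl) (old (here refl) eq)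
    ; keeps    = keeps′
    ; reflects = λ e∈X eq → S.reflects (there e∈X) (old (there e∈X) eq)
    }
    where
    module S = Shifted (shift xs! val free)
    c₁ = S.c′
    b∉a∷X = Free⇒∉ free
    a≢b : a ≢ b
    a≢b a≡b = b∉a∷X (here (sym a≡b))
    bounded′ : ∀ e → size xs (c₁ [ x ≔ b ]) e ≤ m
    bounded′ e with e ≟ b
    ... | yes refl = ≤-trans (≔-size-≤ xs!) S.vacant
    ... | no  e≢b  = ≤-trans (≔-size-≢ xs e≢b) (bounded S.valid e)
    old : ∀ {y e} → e ∈ a ∷ X → (c₁ [ x ≔ b ]) y ≡ e → c₁ y ≡ e
    old e∈ = ≔-shrinks λ { refl → b∉a∷X e∈ }
    keeps′ : ∀ {y e} → e ∈ X → c y ≡ e → (c₁ [ x ≔ b ]) y ≡ e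
    keeps′ {y} e∈X cy≡e = trans (≔-≢ c₁ y≢x) (S.keeps (there e∈X) cy≡e)
      where y≢x = λ { refl → a∉X (subst (_∈ X) (trans (sym cy≡e) cx≡a) e∈X) }

  place : ∀ {v xs c b} → Unique (v ∷ xs) → Valid xs c → b ∈ L v → nbrs xs c v b ≤ 1 →
    size xs c b < m → Valid (v ∷ xs) (c [ v ≔ b ])
  place {v} {xs} {c} {b} (v∉xs ∷ xs!) val b∈L nbrs≤1 b<m = record
    { fromList = ≔-fromList (λ y∈ y≢v → fromList val (tail y∈ y≢v)) b∈L
    ; bounded  = bounded′
    ; coreless = ≔-coreless tail nbrs≤1 (coreless val)
    }
    where
    tail : ∀ {y} → y ∈ v ∷ xs → y ≢ v → y ∈ xs
    tail (here y≡v) y≢v = contradiction y≡v y≢v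
    tail (there y∈) _   = y∈
    bounded′ : ∀ e → size (v ∷ xs) (c [ v ≔ b ]) e ≤ m
    bounded′ e with e ≟ b
    ... | yes refl = ≤-trans (+-mono-≤ (⟦⟧-mono _ (v ≟ᵛ v) (λ _ → refl)) (∑-mono xs λ {y} y∈ →
            ⟦⟧-mono _ (c y ≟ b) (trans (sym (≔-≢ c (All.lookup v∉xs y∈ ∘ sym))))))
            (subst (λ n → n + size xs c b ≤ m) (sym (⟦⟧-yes (v ≟ᵛ v) refl)) b<m)
    ... | no e≢b   = ≤-trans (≤-reflexive (cong (_+ size xs (c [ v ≔ b ]) e)
            (⟦⟧-no (_ ≟ e) (λ eq → e≢b (trans (sym eq) (≔-≡ c v b))))))
            (≤-trans (≔-size-≢ xs e≢b) (bounded val e))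

  -- The set of colours from which no chain makes room.

  record Blocked (xs : List V) (c : Colouring) : Set where
    field
      colours : List ℕ
      unique  : Unique colours
      free    : ∀ {a} → a ∉ colours → Free xs c colours a
      full    : ∀ {a} → a ∈ colours → m ≤ size xs c a
      stuck   : ∀ {x e} → x ∈ xs → c x ∈ colours → e ∈ L x → e ∉ colours → 2 ≤ nbrs xs c x e

  module _ (xs : List V) (c : Colouring) where

    Releasable : List ℕ → ℕ → Set
    Releasable B a = size xs c a < m
      ⊎ Any (λ x → c x ≡ a × Any (λ e → e ∉ B × nbrs xs c x e ≤ 1) (L x)) xs

    releasable? : ∀ B → Decidable (Releasable B)
    releasable? B a = (size xs c a <? m)
      ⊎-dec anyᴸ? (λ x → (c x ≟ a) ×-dec anyᴸ? (λ e → (e ∉? B) ×-dec (nbrs xs c x e ≤? 1)) (L x)) xs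

    -- Colours are removed from `B` one at a time, as long as one has room or contains a vertex that
    -- can move to a colour already outside `B`. When none is left, the failure of the two
    -- alternatives gives `full` and `stuck`. The argument `n` only bounds the number of removals.
    release : ∀ n B → length B < n → Unique B → (∀ {a} → a ∉ B → Free xs c B a) → Blocked xs c
    release (suc n) B (s≤s B≤n) B! free with anyᴸ? (releasable? B) B
    ... | no none = record
      { colours = B ; unique = B! ; free = free
      ; full    = λ a∈B → ≮⇒≥ λ a<m → none (lose a∈B (inj₁ a<m))
      ; stuck   = λ x∈ cx∈B e∈L e∉B → ≰⇒> λ nbrs≤1 →
          none (lose cx∈B (inj₂ (lose x∈ (refl , lose e∈L (e∉B , nbrs≤1)))))
      }
    ... | yes some with find some
    ...   | a , a∈B , rel =
      release n B′ (≤-trans (filter-notAll a≢? B (lose a∈B λ a≢a → a≢a refl)) B≤n)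
        (filter⁺ a≢? B!) free′
      where
      a≢? = λ e → ¬? (a ≟ e)
      B′ = filter a≢? B
      B′⊆B : ∀ {e} → e ∈ B′ → e ∈ B
      B′⊆B = proj₁ ∘ ∈-filter⁻ a≢?
      a∉B′ : a ∉ B′
      a∉B′ a∈B′ = proj₂ (∈-filter⁻ a≢? {xs = B} a∈B′) refl
      freeₐ : Releasable B a → Free xs c B′ a
      freeₐ (inj₁ a<m) = room a∉B′ a<m
      freeₐ (inj₂ movable) with find movable
      ... | x , x∈ , cx≡a , e∈ with find e∈
      -- The chain from `e` avoids `B`, which contains `a`, so prefixing `a` keeps the path simple.
      ...   | e , e∈L , e∉B , nbrs≤1 = step a∉B′ x∈ cx≡a e∈L nbrs≤1
        (Free-anti (λ { (here refl) → a∈B ; (there e∈B′) → B′⊆B e∈B′ }) (free e∉B))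
      free′ : ∀ {e} → e ∉ B′ → Free xs c B′ e
      free′ {e} e∉B′ with a ≟ e
      ... | yes refl = freeₐ rel
      ... | no a≢e   = Free-anti B′⊆B (free λ e∈B → e∉B′ (∈-filter⁺ a≢? e∈B a≢e))

    blocked : 0 < m → Blocked xs c
    -- The removal starts from the colours in use: any other colour has an empty class, hence room.
    blocked 0<m = release _ used ≤-refl (deduplicate-! (map c xs)) λ a∉ → room a∉ (≤-trans (s≤s (unused a∉)) 0<m)
      where
      used = deduplicate _≟_ (map c xs)
      unused : ∀ {a} → a ∉ used → size xs c a ≤ 0
      unused {a} a∉ = ≤-trans
        (∑≤length* xs _ 0 λ {y} y∈ → ≤-reflexive (⟦⟧-no (c y ≟ a)
          λ { refl → a∉ (∈-deduplicate⁺ _≟_ (∈-map⁺ c y∈)) }))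
        (≤-reflexive (*-zeroʳ (length xs)))

  -- Edge counting, and the extension of a colouring by one vertex.

  module _ {d k : ℕ} (degree≤ : ∀ (u : V) {ys : List V} → Unique ys → ∑[ y ∈ ys ] ⟦ u ~? y ⟧ ≤ 2 * d) where

    module Count {xs : List V} {c : Colouring} (blk : Blocked xs c) where
      open Blocked blk

      inside? : Decidable (λ x → c x ∈ colours)
      inside? x = c x ∈? colours

      outside? : Decidable (λ x → c x ∉ colours)
      outside? = ¬? ∘ inside?

      inside outside : List V
      inside  = filter inside? xs
      outside = filter outside? xs

      colours*m≤inside : length colours * m ≤ length inside
      colours*m≤inside = begin
        length colours * m                                ≤⟨ ≤-length*∑ colours _ m full ⟩
        ∑[ b ∈ colours ] ∑[ x ∈ xs ] ⟦ c x ≟ b ⟧          ≡⟨ ∑-swap colours xs (λ b x → ⟦ c x ≟ b ⟧) ⟩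
        ∑[ x ∈ xs ] ∑[ b ∈ colours ] ⟦ c x ≟ b ⟧
          ≤⟨ ∑-mono xs (λ {x} _ → ∑-≡-≤⟦⟧ _≟_ (_∈? colours) unique id (c x)) ⟩
        ∑[ x ∈ xs ] ⟦ inside? x ⟧                         ≡⟨ length-filter≡∑ inside? xs ⟨
        length inside                                     ∎
        where open ≤-Reasoning

      -- The two neighbours found in each outside colour of the list of `w` are counted once, since
      -- a vertex has only one colour.
      outer-degree : ∀ w → Unique (L w) → length (L w) ≡ k →
        (∀ {e} → e ∈ L w → e ∉ colours → 2 ≤ nbrs xs c w e) →
        (k ∸ length colours) * 2 ≤ ∑[ u ∈ outside ] ⟦ w ~? u ⟧
      outer-degree w L! |L|≡k two = begin
        (k ∸ length colours) * 2   ≤⟨ *-monoˡ-≤ 2 missing ⟩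
        length E * 2               ≤⟨ ≤-length*∑ E _ 2 (λ e∈ → two (E⊆L e∈) (E∉ e∈)) ⟩
        ∑[ e ∈ E ] nbrs xs c w e   ≡⟨ ∑-swap E xs (λ e u → ⟦ w ~? u ⟧ * ⟦ c u ≟ e ⟧) ⟩
        ∑[ u ∈ xs ] ∑[ e ∈ E ] (⟦ w ~? u ⟧ * ⟦ c u ≟ e ⟧)
          ≤⟨ ∑-mono xs (λ {u} _ → ≤-trans (≤-reflexive (sym (∑-*ˡ ⟦ w ~? u ⟧ E (λ e → ⟦ c u ≟ e ⟧))))
               (*-monoʳ-≤ ⟦ w ~? u ⟧ (∑-≡-≤⟦⟧ _≟_ (λ e → ¬? (e ∈? colours)) E! E∉ (c u)))) ⟩
        ∑[ u ∈ xs ] (⟦ w ~? u ⟧ * ⟦ outside? u ⟧)  ≡⟨ ∑-filter outside? xs _ ⟨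
        ∑[ u ∈ outside ] ⟦ w ~? u ⟧                ∎
        where
        open ≤-Reasoning
        E = filter (λ e → ¬? (e ∈? colours)) (L w)
        E! = filter⁺ (λ e → ¬? (e ∈? colours)) L!
        E⊆L : ∀ {e} → e ∈ E → e ∈ L w
        E⊆L = proj₁ ∘ ∈-filter⁻ (λ e → ¬? (e ∈? colours))
        E∉ : ∀ {e} → e ∈ E → e ∉ colours
        E∉ = proj₂ ∘ ∈-filter⁻ (λ e → ¬? (e ∈? colours)) {xs = L w}
        -- At most `length colours` of the `k` distinct entries of the list can lie in `colours`.
        missing : k ∸ length colours ≤ length E
        missing = m≤n+o⇒m∸n≤o k (length colours) (≤-trans
          (≤-reflexive (trans (sym |L|≡k) (sym (length-filter-split (_∈? colours) (L w)))))
          (+-monoˡ-≤ (length E) (Unique-⊆⇒length≤ _≟_ (filter⁺ (_∈? colours) L!)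
            (proj₂ ∘ ∈-filter⁻ (_∈? colours) {xs = L w}))))

      -- The edges between `W` and `outside` are counted from both ends; at the outside end the
      -- degree bound applies.
      double-count : ∀ {W n} → Unique W →
        (∀ {w} → w ∈ W → n ≤ ∑[ u ∈ outside ] ⟦ w ~? u ⟧) → length W * n ≤ length outside * (2 * d)
      double-count {W} {n} W! n≤ = begin
        length W * n                                  ≤⟨ ≤-length*∑ W _ n n≤ ⟩
        ∑[ w ∈ W ] ∑[ u ∈ outside ] ⟦ w ~? u ⟧        ≡⟨ ∑-swap W outside (λ w u → ⟦ w ~? u ⟧) ⟩
        ∑[ u ∈ outside ] ∑[ w ∈ W ] ⟦ w ~? u ⟧
          ≤⟨ ∑≤length* outside _ (2 * d) (λ {u} _ → ≤-trans
               (∑-mono W (λ {w} _ → ⟦⟧-mono (w ~? u) (u ~? w) ~-sym)) (degree≤ u W!)) ⟩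
        length outside * (2 * d)                      ∎
        where open ≤-Reasoning

    -- Here p = |B|, and r and q count the vertices coloured inside and outside B.
    impossible : ∀ p q r → p * m ≤ r → r + q < k * m → suc r * ((k ∸ p) * 2) ≤ q * (2 * d) →
      (k ∸ p) * 2 ≤ d → 3 * d ≤ 2 * k → ⊥
    impossible p q r pm≤r r+q<km edges 2a≤d 3d≤2k with k ≤? p
    -- With at least `k` full classes, the vertices coloured inside would already number `k * m`.
    ... | yes k≤p = <-irrefl refl (≤-trans r+q<km (≤-trans (*-monoˡ-≤ m k≤p) (≤-trans pm≤r (m≤m+n r q))))
    -- Since `q < a * m` and `0 < a`, the edge bound `(p * m + 1) * a ≤ q * p` is violated.
    ... | no k≰p = <-irrefl refl (begin-strict
      p + q * p              ≡⟨ lemma₁ p q ⟩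
      p * suc q              ≤⟨ *-monoʳ-≤ p q<am ⟩
      p * (a * m)            <⟨ ≤-trans (m<n+m _ 0<a) (≤-reflexive (lemma₂ p a m)) ⟩
      suc (p * m) * a        ≤⟨ *-cancelʳ-≤ (suc (p * m) * a) (q * p) 2 edges′ ⟩
      q * p                  ≤⟨ m≤n+m (q * p) p ⟩
      p + q * p              ∎)
      where
      open ≤-Reasoning
      a = k ∸ p
      0<a : 0 < a
      0<a = m<n⇒0<n∸m (≰⇒> k≰p)
      k≡p+a : k ≡ p + a
      k≡p+a = sym (m+[n∸m]≡n (<⇒≤ (≰⇒> k≰p)))
      lemma₁ : ∀ p q → p + q * p ≡ p * suc q
      lemma₁ = solve-∀
      lemma₂ : ∀ p a m → a + p * (a * m) ≡ suc (p * m) * a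
      lemma₂ = solve-∀
      lemma₃ : ∀ d → 2 * d + d ≡ 3 * d
      lemma₃ = solve-∀
      lemma₄ : ∀ p a → 2 * (p + a) ≡ 2 * p + a * 2
      lemma₄ = solve-∀
      lemma₅ : ∀ q p → q * (2 * p) ≡ q * p * 2
      lemma₅ = solve-∀
      lemma₆ : ∀ s a → s * (a * 2) ≡ s * a * 2
      lemma₆ = solve-∀
      -- The hypothesis on `k` enters here: `3d ≤ 2k = 2p + 2a` and `2a ≤ d` leave `2d ≤ 2p`.
      d≤p : d ≤ p
      d≤p = *-cancelˡ-≤ 2 (+-cancelʳ-≤ d (2 * d) (2 * p) (begin
        2 * d + d       ≡⟨ lemma₃ d ⟩
        3 * d           ≤⟨ 3d≤2k ⟩
        2 * k           ≡⟨ cong (2 *_) k≡p+a ⟩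
        2 * (p + a)     ≡⟨ lemma₄ p a ⟩
        2 * p + a * 2   ≤⟨ +-monoʳ-≤ (2 * p) 2a≤d ⟩
        2 * p + d       ∎))
      q<am : q < a * m
      q<am = +-cancelˡ-≤ (p * m) (suc q) (a * m) (begin
        p * m + suc q   ≡⟨ +-suc (p * m) q ⟩
        suc (p * m + q) ≤⟨ s≤s (+-monoˡ-≤ q pm≤r) ⟩
        suc (r + q)     ≤⟨ r+q<km ⟩
        k * m           ≡⟨ cong (_* m) k≡p+a ⟩
        (p + a) * m     ≡⟨ *-distribʳ-+ m p a ⟩
        p * m + a * m   ∎)
      edges′ : suc (p * m) * a * 2 ≤ q * p * 2
      edges′ = begin
        suc (p * m) * a * 2    ≡⟨ lemma₆ (suc (p * m)) a ⟨
        suc (p * m) * (a * 2)  ≤⟨ *-monoˡ-≤ (a * 2) (s≤s pm≤r) ⟩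
        suc r * (a * 2)        ≤⟨ edges ⟩
        q * (2 * d)            ≤⟨ *-monoʳ-≤ q (*-monoʳ-≤ 2 d≤p) ⟩
        q * (2 * p)            ≡⟨ lemma₅ q p ⟩
        q * p * 2              ∎

    module _ {v : V} {xs : List V} {c : Colouring} (3d≤2k : 3 * d ≤ 2 * k) (vxs! : Unique (v ∷ xs))
      (lists : ∀ {u : V} → u ∈ v ∷ xs → Unique (L u) × length (L u) ≡ k)
      (back : ∑[ y ∈ xs ] ⟦ v ~? y ⟧ ≤ d) (xs<km : length xs < k * m) where

      xs! : Unique xs
      xs! = AllPairs.tail vxs!

      -- Otherwise `v` would have two neighbours in every outside colour of its list, just like the
      -- vertices coloured inside, and could be counted along with them.
      free-colour : (blk : Blocked xs c) →
        Any (λ e → e ∉ Blocked.colours blk × nbrs xs c v e ≤ 1) (L v)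
      free-colour blk with anyᴸ? (λ e → (e ∉? Blocked.colours blk) ×-dec (nbrs xs c v e ≤? 1)) (L v)
      ... | yes good = good
      ... | no bad = ⊥-elim (impossible (length colours) (length outside) (length inside)
        colours*m≤inside
        (subst (_< k * m) (sym (length-filter-split inside? xs)) xs<km)
        (double-count W! outer)
        -- Only the neighbours of `v` already coloured count here, and there are at most `d` of
        -- them.
        (≤-trans (outer (here refl)) outer≤back)
        3d≤2k)
        where
        open Blocked blk
        open Count blk
        W : List V
        W = v ∷ inside
        W! : Unique W
        W! = All.filter⁺ inside? (AllPairs.head vxs!) ∷ filter⁺ inside? xs!
        W⊆ : ∀ {w} → w ∈ W → w ∈ v ∷ xs
        W⊆ (here w≡v) = here w≡v
        W⊆ (there w∈) = there (proj₁ (∈-filter⁻ inside? w∈))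
        two : ∀ {w} → w ∈ W → ∀ {e} → e ∈ L w → e ∉ colours → 2 ≤ nbrs xs c w e
        two (here refl) e∈L e∉B = ≰⇒> λ nbrs≤1 → bad (lose e∈L (e∉B , nbrs≤1))
        two (there w∈)  = stuck (proj₁ (∈-filter⁻ inside? w∈)) (proj₂ (∈-filter⁻ inside? {xs = xs} w∈))
        outer : ∀ {w} → w ∈ W → (k ∸ length colours) * 2 ≤ ∑[ u ∈ outside ] ⟦ w ~? u ⟧
        outer w∈ = outer-degree _ (proj₁ (lists (W⊆ w∈))) (proj₂ (lists (W⊆ w∈))) (two w∈)
        outer≤back : ∑[ u ∈ outside ] ⟦ v ~? u ⟧ ≤ d
        outer≤back = begin
          ∑[ u ∈ outside ] ⟦ v ~? u ⟧                ≡⟨ ∑-filter outside? xs _ ⟩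
          ∑[ u ∈ xs ] (⟦ v ~? u ⟧ * ⟦ outside? u ⟧)
            ≤⟨ ∑-mono xs (λ {u} _ → ≤-trans (*-monoʳ-≤ ⟦ v ~? u ⟧ (⟦⟧≤1 (outside? u)))
                 (≤-reflexive (*-identityʳ _))) ⟩
          ∑[ u ∈ xs ] ⟦ v ~? u ⟧                     ≤⟨ back ⟩
          d                                          ∎
          where open ≤-Reasoning

      0<cap : 0 < m
      0<cap with m ≟ 0
      ... | yes refl = contradiction (subst (length xs <_) (*-zeroʳ k) xs<km) λ ()
      ... | no  m≢0  = n≢0⇒n>0 m≢0

      extend : Valid xs c → ∃ (Valid (v ∷ xs))
      extend val with blk ← blocked xs c 0<cap with find (free-colour blk)
      ... | e , e∈L , e∉B , nbrs≤1 =
        S.c′ [ v ≔ e ] , place vxs! S.valid e∈L (≤-trans (nbrs-mono xs S.shrinks) nbrs≤1) S.vacant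
        where module S = Shifted (shift xs! val (Blocked.free blk e∉B))

-- Adjacency and degrees in the grid.

private variable
  d : ℕ

Adj-sym : ∀ (x y : Vec ℕ d) → Adj x y → Adj y x
Adj-sym _ _ (i , inj₁ eq , same) = i , inj₂ eq , λ j j≢i → sym (same j j≢i)
Adj-sym _ _ (i , inj₂ eq , same) = i , inj₁ eq , λ j j≢i → sym (same j j≢i)

Adj-irrefl : ∀ {x : Vec ℕ d} → ¬ Adj x x
Adj-irrefl (i , inj₁ eq , _) = 1+n≢n (sym eq)
Adj-irrefl (i , inj₂ eq , _) = 1+n≢n (sym eq)

adj? : ∀ (x y : Vec ℕ d) → Dec (Adj x y)
adj? x y = any? λ i →
  ((lookup x i ≟ suc (lookup y i)) ⊎-dec (lookup y i ≟ suc (lookup x i)))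
  ×-dec all? λ j → ¬? (j ≟ᶠ i) →-dec (lookup x j ≟ lookup y j)

lookup-ext : ∀ (x y : Vec ℕ d) → (∀ i → lookup x i ≡ lookup y i) → x ≡ y
lookup-ext x y eq = trans (sym (tabulate∘lookup x)) (trans (tabulate-cong eq) (tabulate∘lookup y))

Adj-∷⁻ : ∀ {a b} {x y : Vec ℕ d} → Adj (a ∷ x) (b ∷ y) →
  (x ≡ y × (a ≡ suc b ⊎ b ≡ suc a)) ⊎ (a ≡ b × Adj x y)
Adj-∷⁻ (zero , step , same)  = inj₁ (lookup-ext _ _ (λ j → same (suc j) λ ()) , step)
Adj-∷⁻ (suc i , step , same) =
  inj₂ (same zero (λ ()) , i , step , λ j j≢i → same (suc j) λ { refl → j≢i refl })

-- These lists serve as upper bounds: they may leave the grid, and a coordinate `0` lists the vertex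
-- itself because `pred 0` is `0`.
neighbours lower : Vec ℕ d → List (Vec ℕ d)
neighbours []      = []
neighbours (a ∷ x) = (suc a ∷ x) ∷ (pred a ∷ x) ∷ map (a ∷_) (neighbours x)
lower []      = []
lower (a ∷ x) = (pred a ∷ x) ∷ map (a ∷_) (lower x)

length-neighbours : ∀ (x : Vec ℕ d) → length (neighbours x) ≡ 2 * d
length-neighbours []                = refl
length-neighbours {suc d} (a ∷ x) =
  cong suc (trans (cong suc (trans (length-map (a ∷_) (neighbours x)) (length-neighbours x)))
                  (sym (+-suc d (d + 0))))

length-lower : ∀ (x : Vec ℕ d) → length (lower x) ≡ d
length-lower []      = refl
length-lower (a ∷ x) = cong suc (trans (length-map (a ∷_) (lower x)) (length-lower x))

Adj⇒∈neighbours : ∀ {x y : Vec ℕ d} → Adj x y → y ∈ neighbours x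
Adj⇒∈neighbours {x = []}    {[]}    (() , _)
Adj⇒∈neighbours {x = a ∷ x} {b ∷ y} adj with Adj-∷⁻ adj
... | inj₁ (refl , inj₁ refl) = there (here refl)
... | inj₁ (refl , inj₂ refl) = here refl
... | inj₂ (refl , x~y)       = there (there (∈-map⁺ (a ∷_) (Adj⇒∈neighbours x~y)))

degree≤length : ∀ (u : Vec ℕ d) {xs ys} → Unique xs → (∀ {x} → x ∈ xs → Adj u x → x ∈ ys) →
  ∑[ x ∈ xs ] ⟦ adj? u x ⟧ ≤ length ys
degree≤length u {xs} {ys} xs! nbrs⊆ys = ≤-trans
  (≤-reflexive (sym (length-filter≡∑ (adj? u) xs)))
  (Unique-⊆⇒length≤ (≡-dec _≟_) (filter⁺ (adj? u) xs!) λ x∈ →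
    nbrs⊆ys (proj₁ (∈-filter⁻ (adj? u) x∈)) (proj₂ (∈-filter⁻ (adj? u) {xs = xs} x∈)))

-- Lexicographic enumeration of the grid.

length-cartesianProductWith : ∀ {C : Set} (f : A → B → C) xs ys →
  length (cartesianProductWith f xs ys) ≡ length xs * length ys
length-cartesianProductWith f []       ys = refl
length-cartesianProductWith f (x ∷ xs) ys = trans (length-++ (map (f x) ys))
  (cong₂ _+_ (length-map (f x) ys) (length-cartesianProductWith f xs ys))

-- Lexicographically decreasing, so that the suffixes are the lexicographic initial segments.
grid : Vec ℕ d → List (Vec ℕ d)
grid []      = [] ∷ []
grid (n ∷ ns) = cartesianProductWith _∷_ (downFrom n) (grid ns)

length-grid : ∀ (n : Vec ℕ d) → length (grid n) ≡ numVertices n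
length-grid []       = refl
length-grid (n ∷ ns) = trans (length-cartesianProductWith _∷_ (downFrom n) (grid ns))
  (cong₂ _*_ (length-downFrom n) (length-grid ns))

∈-grid⁺ : ∀ (n x : Vec ℕ d) → InGrid n x → x ∈ grid n
∈-grid⁺ []       []      _  = here refl
∈-grid⁺ (n ∷ ns) (a ∷ x) x< =
  ∈-cartesianProductWith⁺ _∷_ (∈-downFrom⁺ (x< zero)) (∈-grid⁺ ns x (x< ∘ suc))

∈-grid⁻ : ∀ (n : Vec ℕ d) {x} → x ∈ grid n → InGrid n x
∈-grid⁻ []       _  ()
∈-grid⁻ (n ∷ ns) x∈ i with ∈-cartesianProductWith⁻ _∷_ (downFrom n) (grid ns) x∈
∈-grid⁻ (n ∷ ns) x∈ zero    | a , y , a∈ , y∈ , refl = ∈-downFrom⁻ a∈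
∈-grid⁻ (n ∷ ns) x∈ (suc i) | a , y , a∈ , y∈ , refl = ∈-grid⁻ ns y∈ i

grid-! : ∀ (n : Vec ℕ d) → Unique (grid n)
grid-! []       = [] ∷ []
grid-! (n ∷ ns) = cartesianProductWith⁺ _∷_ ∷-injective (downFrom⁺ n) (grid-! ns)

-- Meant for `y` behind `x` in the enumeration, thus coloured before `x`: such neighbours number at
-- most `d`.
LaterLower : Vec ℕ d → Vec ℕ d → Set
LaterLower x y = Adj x y → y ∈ lower x

-- Within a layer of constant first coordinate this is the induction hypothesis. Between layers,
-- adjacency forces equal remaining coordinates and a first coordinate lower by one.
grid-lower : ∀ (n : Vec ℕ d) → AllPairs LaterLower (grid n)
grid-lower []       = [] ∷ []
grid-lower (n ∷ ns) = layers n
  where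
  layer : ∀ a {x y} → LaterLower x y → LaterLower (a ∷ x) (a ∷ y)
  layer a later adj with Adj-∷⁻ adj
  ... | inj₁ (_ , inj₁ a≡1+a) = contradiction (sym a≡1+a) 1+n≢n
  ... | inj₁ (_ , inj₂ a≡1+a) = contradiction (sym a≡1+a) 1+n≢n
  ... | inj₂ (_ , x~y)        = there (∈-map⁺ (a ∷_) (later x~y))
  below : ∀ {a b} x y → b < a → LaterLower (a ∷ x) (b ∷ y)
  below x y b<a adj with Adj-∷⁻ adj
  ... | inj₁ (refl , inj₁ refl) = here refl
  ... | inj₁ (_ , inj₂ refl)    = contradiction b<a (≤⇒≯ (n≤1+n _))
  ... | inj₂ (refl , _)         = contradiction b<a (<-irrefl refl)
  layers : ∀ n → AllPairs LaterLower (cartesianProductWith _∷_ (downFrom n) (grid ns))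
  layers zero    = []
  layers (suc n) = AllPairs.++⁺
    (AllPairs.map⁺ (AllPairs.map (layer n) (grid-lower ns)))
    (layers n)
    (All.tabulate λ x∈ → All.tabulate λ y∈ → cross x∈ y∈)
    where
    cross : ∀ {x y} → x ∈ map (n ∷_) (grid ns) →
      y ∈ cartesianProductWith _∷_ (downFrom n) (grid ns) → LaterLower x y
    cross x∈ y∈
      with ∈-map⁻ (n ∷_) x∈ | ∈-cartesianProductWith⁻ _∷_ (downFrom n) (grid ns) y∈
    ... | x′ , _ , refl | b , y′ , b∈ , _ , refl = below x′ y′ (∈-downFrom⁻ b∈)

-- Cycles as cores, and the colouring of the whole grid.

last-∈ : ∀ (xs : List A) {w} → last xs ≡ just w → w ∈ xs
last-∈ (x ∷ [])     refl = here refl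
last-∈ (x ∷ y ∷ xs) eq   = there (last-∈ (y ∷ xs) eq)

module _ {d : ℕ} (L : Vec ℕ d → List ℕ) (m : ℕ) where

  open Recolouring (≡-dec _≟_) adj? (λ {x} {y} → Adj-sym x y) (λ {x} → Adj-irrefl {x = x}) L m

  TwoNeighbours : List (Vec ℕ d) → Vec ℕ d → Set
  TwoNeighbours T x = ∃₂ λ y z → y ∈ T × z ∈ T × y ≢ z × Adj x y × Adj x z

  -- Walks along the cycle minus its starting vertex `v`, with `p` the predecessor: an inner vertex
  -- has its two path neighbours, the last one has its predecessor and `v`.
  path-two : ∀ {T v w p x xs} → Linked Adj (p ∷ x ∷ xs) → Unique (p ∷ x ∷ xs) →
    All (v ≢_) (p ∷ x ∷ xs) → v ∈ T → (∀ {y} → y ∈ p ∷ x ∷ xs → y ∈ T) →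
    last (x ∷ xs) ≡ just w → Adj w v → ∀ {y} → y ∈ x ∷ xs → TwoNeighbours T y
  path-two {p = p} {x} {[]} (p~x ∷ _) _ (v≢p ∷ _) v∈T ⊆T refl w~v (here refl) =
    _ , _ , ⊆T (here refl) , v∈T , v≢p ∘ sym , Adj-sym p x p~x , w~v
  path-two {p = p} {x} {z ∷ zs} (p~x ∷ x~z ∷ _) ((_ ∷ p≢z ∷ _) ∷ _) _ v∈T ⊆T _ _ (here refl) =
    _ , _ , ⊆T (here refl) , ⊆T (there (there (here refl))) , p≢z , Adj-sym p x p~x , x~z
  path-two {xs = z ∷ zs} (_ ∷ link) (_ ∷ unique) (_ ∷ v∉) v∈T ⊆T last≡w w~v (there y∈) =
    path-two link unique v∉ v∈T (⊆T ∘ there) last≡w w~v y∈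

  cycle⇒Core : ∀ {n c a vs} → CycleInClass n c a vs → Core vs
  cycle⇒Core {vs = _ ∷ []}     (s≤s () , _)
  cycle⇒Core {vs = _ ∷ _ ∷ []} (s≤s (s≤s ()) , _)
  cycle⇒Core {vs = v ∷ x ∷ y ∷ ys}
    (_ , (v≢x ∷ v≢y ∷ v∉) ∷ x∉ ∷ unique , _ , v~x ∷ x~y ∷ link , w , last≡w , w~v) =
    (v , here refl) , λ
      -- The starting vertex has the second and the last vertex as neighbours; they differ because
      -- the cycle has at least three vertices.
      { (here refl) → x , w , there (here refl) , there (there w∈) , All.lookup x∉ w∈ , v~x , Adj-sym w v w~v
      ; (there (here refl)) → v , y , here refl , there (there (here refl)) , v≢y , Adj-sym v x v~x , x~y
      ; (there (there z∈)) → path-two (x~y ∷ link) (x∉ ∷ unique) (v≢x ∷ v≢y ∷ v∉)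
          (here refl) there last≡w w~v z∈ }
    where
    w∈ : w ∈ y ∷ ys
    w∈ = last-∈ (y ∷ ys) last≡w

  Valid⇒coloured : ∀ {n c} → Valid (grid n) c →
    IsLColouring n L c × (∀ a → ClassSizeAtMost n c a m) × ClassesAcyclic n c
  Valid⇒coloured {n} {c} val =
    (λ x x∈ → fromList (∈-grid⁺ n x x∈)) ,
    (λ a vs vs! vs⊆a → ≤-trans
      (Unique-⊆⇒length≤ (≡-dec _≟_) vs! λ v∈ → let v< , cv≡a = All.lookup vs⊆a v∈ in
        ∈-filter⁺ (λ x → c x ≟ a) (∈-grid⁺ n _ v<) cv≡a)
      (≤-trans (≤-reflexive (length-filter≡∑ (λ x → c x ≟ a) (grid n))) (bounded a))) ,
    (λ { a (v ∷ vs) cycle@(_ , _ , vs⊆a , _) → coreless a (cycle⇒Core {n} {c} {a} {v ∷ vs} cycle)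
      (All.map (λ { (x< , cx≡a) → ∈-grid⁺ n _ x< , cx≡a }) vs⊆a) })
    where open Valid val

  module _ {n : Vec ℕ d} {k : ℕ} (lists : UniformListAssignment n k L) (3d≤2k : 3 * d ≤ 2 * k) where

    -- Induction from the end of the list: when `v` is reached, exactly the entries behind it are
    -- coloured.
    colour-suffix : ∀ xs → (∀ {x} → x ∈ xs → x ∈ grid n) → Unique xs → AllPairs LaterLower xs →
      length xs ≤ k * m → ∃ (Valid xs)
    colour-suffix [] _ _ _ _ = (λ _ → 0) , record
      { fromList = λ ()
      ; bounded  = λ _ → z≤n
      ; coreless = λ { _ ((_ , x∈) , _) T⊆[] → case proj₁ (All.lookup T⊆[] x∈) of λ () }
      }
    colour-suffix (v ∷ xs) ⊆grid xs!@(_ ∷ tail!) (lower-v ∷ tail-lower) |xs|≤ =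
      extend (λ u ys! → ≤-trans (degree≤length u ys! (λ _ → Adj⇒∈neighbours {x = u})) (≤-reflexive (length-neighbours u)))
        3d≤2k xs! (λ u∈ → lists _ (∈-grid⁻ n (⊆grid u∈)))
        (≤-trans (degree≤length v tail! (All.lookup lower-v)) (≤-reflexive (length-lower v)))
        -- The bound for `v ∷ xs` is by definition the strict bound `length xs < k * m` that
        -- `extend` asks for.
        |xs|≤ (proj₂ (colour-suffix xs (⊆grid ∘ there) tail! tail-lower (≤-trans (n≤1+n _) |xs|≤)))

-- The numerical bounds.

≤-*ceilDiv : ∀ N {k} → 0 < k → N ≤ k * ceilDiv N k
≤-*ceilDiv N {suc j} _ = +-cancelʳ-≤ j N (suc j * q) (begin
  N + j                       ≡⟨ m≡m%n+[m/n]*n (N + j) (suc j) ⟩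
  -- The remainder is at most `j`, which is what rounding up added.
  (N + j) % suc j + q * suc j ≤⟨ +-monoˡ-≤ _ (≤-pred (m%n<n (N + j) (suc j))) ⟩
  j + q * suc j               ≡⟨ +-comm j _ ⟩
  q * suc j + j               ≡⟨ cong (_+ j) (*-comm q (suc j)) ⟩
  suc j * q + j               ∎)
  where
  open ≤-Reasoning
  q = (N + j) / suc j

equitablyListArborable : ∀ {d k} → 0 < k → 3 * d ≤ 2 * k → (n : Vec ℕ d) → EquitablyListArborable n k
equitablyListArborable {d} {k} 0<k 3d≤2k n L lists =
  let c , val = colour-suffix L m {n} lists 3d≤2k (grid n) id (grid-! n) (grid-lower n)
                  (subst (_≤ k * m) (sym (length-grid n)) (≤-*ceilDiv (numVertices n) 0<k))
  in c , Valid⇒coloured L m {n} val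
  where m = ceilDiv (numVertices n) k

-- The bounds on `k` are cleared of denominators: (ii) becomes `7k ≥ 16d - 18` and (iii) becomes
-- `6k ≥ 14d - 21`. Each range is reduced to `3d ≤ 2k`.
theorem14 : ((k : ℕ) → 8 ≤ k → (n : Vec ℕ 5) → IsGrid n → EquitablyListArborable n k)
    × ((d k : ℕ) → 6 ≤ d → d ≤ 16 → 16 * d ∸ 18 ≤ 7 * k →
    (n : Vec ℕ d) → IsGrid n → EquitablyListArborable n k)
    × ((d k : ℕ) → 17 ≤ d → 14 * d ≤ 6 * k + 21 →
    (n : Vec ℕ d) → IsGrid n → EquitablyListArborable n k)
theorem14 = part₁ , part₂ , part₃
  where
  open ≤-Reasoning
  positive : ∀ {d k} → 1 ≤ d → 3 * d ≤ 2 * k → 0 < k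
  positive {k = suc k} _ _     = s≤s z≤n
  positive {k = zero}  1≤d 3d≤ = contradiction (≤-trans (*-monoʳ-≤ 3 1≤d) 3d≤) λ ()

  part₁ : (k : ℕ) → 8 ≤ k → (n : Vec ℕ 5) → IsGrid n → EquitablyListArborable n k
  part₁ k 8≤k n _ = equitablyListArborable (≤-trans (s≤s z≤n) 8≤k)
    (≤-trans (n≤1+n 15) (*-monoʳ-≤ 2 8≤k)) n

  part₂ : (d k : ℕ) → 6 ≤ d → d ≤ 16 → 16 * d ∸ 18 ≤ 7 * k →
    (n : Vec ℕ d) → IsGrid n → EquitablyListArborable n k
  part₂ d k 6≤d _ hyp n _ = equitablyListArborable (positive (≤-trans (s≤s z≤n) 6≤d) 3d≤2k) 3d≤2k n
    where
    eq₁ : ∀ d → 7 * (3 * d) + 11 * d ≡ 2 * (16 * d)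
    eq₁ = solve-∀
    eq₂ : ∀ k → 2 * (18 + 7 * k) ≡ 7 * (2 * k) + 36
    eq₂ = solve-∀
    3d≤2k : 3 * d ≤ 2 * k
    3d≤2k = *-cancelˡ-≤ 7 (+-cancelʳ-≤ 36 _ _ (begin
      -- Twice the hypothesis reads `32d ≤ 14k + 36`; of the left side `21d` is kept, and `11d ≥ 66`
      -- absorbs the constant `36`.
      7 * (3 * d) + 36       ≤⟨ +-monoʳ-≤ (7 * (3 * d)) (≤-trans (m≤m+n 36 30) (*-monoʳ-≤ 11 6≤d)) ⟩
      7 * (3 * d) + 11 * d   ≡⟨ eq₁ d ⟩
      2 * (16 * d)           ≤⟨ *-monoʳ-≤ 2 (≤-trans (m≤n+m∸n (16 * d) 18) (+-monoʳ-≤ 18 hyp)) ⟩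
      2 * (18 + 7 * k)       ≡⟨ eq₂ k ⟩
      7 * (2 * k) + 36       ∎))

  part₃ : (d k : ℕ) → 17 ≤ d → 14 * d ≤ 6 * k + 21 →
    (n : Vec ℕ d) → IsGrid n → EquitablyListArborable n k
  part₃ d k 17≤d hyp n _ = equitablyListArborable (positive (≤-trans (s≤s z≤n) 17≤d) 3d≤2k) 3d≤2k n
    where
    eq₁ : ∀ d → 3 * (3 * d) + 5 * d ≡ 14 * d
    eq₁ = solve-∀
    eq₂ : ∀ k → 6 * k + 21 ≡ 3 * (2 * k) + 21
    eq₂ = solve-∀
    3d≤2k : 3 * d ≤ 2 * k
    3d≤2k = *-cancelˡ-≤ 3 (+-cancelʳ-≤ 21 _ _ (begin
      -- Of `14d`, the part `9d` is kept, and `5d ≥ 85` absorbs the constant `21`.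
      3 * (3 * d) + 21       ≤⟨ +-monoʳ-≤ (3 * (3 * d)) (≤-trans (m≤m+n 21 64) (*-monoʳ-≤ 5 17≤d)) ⟩
      3 * (3 * d) + 5 * d    ≡⟨ eq₁ d ⟩
      14 * d                 ≤⟨ hyp ⟩
      6 * k + 21             ≡⟨ eq₂ k ⟩
      3 * (2 * k) + 21       ∎))
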